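{- Let $n \geq 4$ be an even integer. Every $4$-total coloring of every cubic graph of order $n$ is equitable if and only if $n \in \{4,6,8,10,14\}$, where the case $n=4$ holds vacuously because $K_4$ admits no $4$-total coloring. In particular, $n = 14$ is the largest order with this property.
   Context: All graphs are finite, simple and cubic ($3$-regular), not necessarily connected. The order of a graph is its number of vertices. A $4$-total coloring of $G$ assigns one of the four colors $1,2,3,4$ to each vertex and each edge of $G$ so that adjacent vertices receive distinct colors, adjacent edges (edges sharing an endpoint) receive distinct colors, and every vertex and edge that are incident receive distinct colors. The color class $c_i$ is the set of all vertices and edges of color $i$. The coloring is equitable if $\bigl||c_i|-|c_j|\bigr| \le 1$ for all $i,j \in \{1,2,3,4\}$. -}

module Defs where

open import Data.Fin using (Fin; _<?_)
open import Data.Fin.Properties using (_≟_)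
open import Data.List using (List; map; _++_; filter; length; allFin; cartesianProduct)
open import Data.Nat using (ℕ; _≤_; ∣_-_∣)
open import Data.Product using (_×_; _,_)
open import Data.Sum using (_⊎_; inj₁; inj₂)
open import Level using (0ℓ)
open import Relation.Binary using (Rel; Decidable; Symmetric; Irreflexive)
open import Relation.Binary.PropositionalEquality using (_≡_; _≢_; ≢-sym)
open import Relation.Nullary.Decidable using (¬?; _×-dec_)

record Graph (n : ℕ) : Set₁ where
  infix 4 _~_ _~?_
  field
    _~_    : Rel (Fin n) 0ℓ
    _~?_   : Decidable _~_
    sym    : Symmetric _~_
    irrefl : Irreflexive _≡_ _~_

  neighbours : Fin n → List (Fin n)
  neighbours u = filter (u ~?_) (allFin n)

  degree : Fin n → ℕ
  degree u = length (neighbours u)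

  -- Each edge {u , v} is listed once, as the pair (u , v) with u < v.
  edges : List (Fin n × Fin n)
  edges = filter (λ { (u , v) → (u <? v) ×-dec (u ~? v) })
                 (cartesianProduct (allFin n) (allFin n))

  elements : List (Fin n ⊎ (Fin n × Fin n))
  elements = map inj₁ (allFin n) ++ map inj₂ edges

Cubic : ∀ {n} → Graph n → Set
Cubic G = ∀ u → Graph.degree G u ≡ 3

Complete : (n : ℕ) → Graph n
Complete n = record
  { _~_    = _≢_
  ; _~?_   = λ u v → ¬? (u ≟ v)
  ; sym    = ≢-sym
  ; irrefl = λ u≡v u≢v → u≢v u≡v
  }

-- edgeColour is meaningful only at adjacent pairs: its values elsewhere are
-- unconstrained and belong to no colour class.  By edge-sym, the conditions
-- below, stated at the first endpoint of an edge, cover both endpoints.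
record TotalColouring (k : ℕ) {n : ℕ} (G : Graph n) : Set where
  open Graph G using (_~_; elements)
  field
    vertexColour : Fin n → Fin k
    edgeColour   : Fin n → Fin n → Fin k
    edge-sym     : ∀ {u v} → u ~ v → edgeColour u v ≡ edgeColour v u
    vertices-ok  : ∀ {u v} → u ~ v → vertexColour u ≢ vertexColour v
    edges-ok     : ∀ {u v w} → u ~ v → u ~ w → v ≢ w →
                   edgeColour u v ≢ edgeColour u w
    incident-ok  : ∀ {u v} → u ~ v → vertexColour u ≢ edgeColour u v

  colour : Fin n ⊎ (Fin n × Fin n) → Fin k
  colour (inj₁ v)       = vertexColour v
  colour (inj₂ (u , v)) = edgeColour u v

  colourClass : Fin k → List (Fin n ⊎ (Fin n × Fin n))
  colourClass i = filter (λ x → colour x ≟ i) elements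

  Equitable : Set
  Equitable = ∀ i j → ∣ length (colourClass i) - length (colourClass j) ∣ ≤ 1

AllEquitable : ℕ → Set₁
AllEquitable n = (G : Graph n) → Cubic G →
                 (c : TotalColouring 4 G) → TotalColouring.Equitable c

{-# OPTIONS --safe #-}
-- Let v_i be the number of vertices of colour i.  Every vertex meets each colour
-- exactly once, so the edges of colour i match up the vertices of other colours, and
-- 2|c_i| = n + v_i.  If i ≠ j, the edges of colour j join distinct vertices of colour
-- i to distinct vertices whose colour is neither i nor j, so 2v_i + v_j ≤ n.  For even
-- n all v_i are even, and these inequalities together with Σ v_i = n force
-- |v_i - v_j| ≤ 2 unless n = 12 or n ≥ 16.
--
-- Conversely, take disjoint unions of coloured graphs with (v_i) = (2,2,2,0) on 6
-- vertices, (2,2,2,2) on 8 vertices and (4,2,2,2) on 10 vertices: the orders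
-- 12 = 6+6, 16 = 6+10, 20 = 6+6+8, each increased by multiples of 6, are the
-- remaining ones, and v_0 - v_3 ≥ 4 there.
module Submission where

open import Defs
open import Data.Bool using (true; false; if_then_else_)
open import Data.Fin using (Fin; zero; suc; toℕ; punchIn; punchOut; _<?_; splitAt; join)
open import Data.Fin.Properties as Fin using (_≟_; all?; any?; punchIn-injective; punchInᵢ≢i; punchIn-punchOut; join-splitAt)
open import Data.List using (List; []; _∷_; _++_; map; filter; length; tabulate; allFin; cartesianProduct)
open import Data.List.Membership.Propositional using (_∈_)
open import Data.List.Properties using (filter-++; length-++)
open import Data.List.Relation.Unary.All as All using (All)
open import Data.List.Relation.Unary.Any using (here; there)
open import Data.Nat as ℕ using (ℕ; zero; suc; _+_; _*_; _≤_; _<_; z≤n; s≤s; ∣_-_∣)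
open import Data.Nat.Divisibility using (_∣_; divides; ∣m+n∣m⇒∣n; n∣m*n)
open import Data.Nat.Properties hiding (_≟_; _<?_)
open import Data.Nat.Tactic.RingSolver using (solve-∀)
open import Data.Product using (_×_; _,_; ∃; proj₁; proj₂)
open import Data.Sum using (_⊎_; inj₁; inj₂; [_,_]′)
open import Data.Sum.Relation.Binary.Pointwise as ⊎ using (Pointwise; inj₁; inj₂)
open import Data.Vec using (Vec; []; _∷_; lookup)
open import Data.Vec.Functional using (removeAt)
open import Function using (_∘_; _on_; _⇔_; mk⇔)
open import Relation.Binary using (tri<; tri≈; tri>)
open import Relation.Binary.PropositionalEquality
open import Relation.Nullary using (¬_; Dec; yes; no; contradiction)
open import Relation.Nullary.Decidable using (does; ¬?; _×-dec_; _→-dec_; from-yes; True; toWitness)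
open import Relation.Unary using (Pred; Decidable)

open import Algebra.Properties.CommutativeMonoid.Sum +-0-commutativeMonoid
  using (sum; sum-syntax; sum-remove; sum-cong-≗; sum-replicate-zero; ∑-distrib-+; ∑-comm)
open import Algebra.Properties.Semiring.Sum +-*-semiring using (*-distribˡ-sum; *-distribʳ-sum)

-- Counting by indicator sums

⟦_⟧ : ∀ {p} {P : Set p} → Dec P → ℕ
⟦ P? ⟧ = if does P? then 1 else 0

⟦⟧-yes : ∀ {p} {P : Set p} (P? : Dec P) → P → ⟦ P? ⟧ ≡ 1
⟦⟧-yes (yes _) p = refl
⟦⟧-yes (no ¬p) p = contradiction p ¬p

⟦⟧-no : ∀ {p} {P : Set p} (P? : Dec P) → ¬ P → ⟦ P? ⟧ ≡ 0
⟦⟧-no (yes p) ¬p = contradiction p ¬p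
⟦⟧-no (no _)  ¬p = refl

⟦⟧-cong : ∀ {p q} {P : Set p} {Q : Set q} (P? : Dec P) (Q? : Dec Q) →
          (P → Q) → (Q → P) → ⟦ P? ⟧ ≡ ⟦ Q? ⟧
⟦⟧-cong (yes p) Q? f g = sym (⟦⟧-yes Q? (f p))
⟦⟧-cong (no ¬p) Q? f g = sym (⟦⟧-no Q? (¬p ∘ g))

⟦⟧-× : ∀ {p q} {P : Set p} {Q : Set q} (P? : Dec P) (Q? : Dec Q) →
       ⟦ P? ×-dec Q? ⟧ ≡ ⟦ P? ⟧ * ⟦ Q? ⟧
⟦⟧-× (yes _) Q? = sym (*-identityˡ _)
⟦⟧-× (no _)  Q? = refl

∑-mono-≤ : ∀ {n} {f g : Fin n → ℕ} → (∀ i → f i ≤ g i) → sum f ≤ sum g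
∑-mono-≤ {zero}  f≤g = z≤n
∑-mono-≤ {suc n} f≤g = +-mono-≤ (f≤g zero) (∑-mono-≤ (f≤g ∘ suc))

∑-zero : ∀ {n} {f : Fin n → ℕ} → (∀ i → f i ≡ 0) → sum f ≡ 0
∑-zero {n} f≡0 = trans (sum-cong-≗ f≡0) (sum-replicate-zero n)

∑-one : ∀ n {f : Fin n → ℕ} → (∀ i → f i ≡ 1) → sum f ≡ n
∑-one zero    f≡1 = refl
∑-one (suc n) f≡1 = cong₂ _+_ (f≡1 zero) (∑-one n (f≡1 ∘ suc))

∑-≤1 : ∀ n {f : Fin n → ℕ} → (∀ i → f i ≤ 1) → sum f ≤ n
∑-≤1 n f≤1 = ≤-trans (∑-mono-≤ f≤1) (≤-reflexive (∑-one n λ _ → refl))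

-- The terms away from `i` contribute at most one less than the number of indices, which leaves at
-- least 1 for `f i`.
∑-saturated : ∀ n {f : Fin n → ℕ} → (∀ i → f i ≤ 1) → sum f ≡ n → ∀ i → f i ≡ 1
∑-saturated (suc n) {f} f≤1 Σf≡n i = ≤-antisym (f≤1 i) (+-cancelʳ-≤ n 1 (f i) (begin
  suc n                      ≡⟨ Σf≡n ⟨
  sum f                      ≡⟨ sum-remove {i = i} f ⟩
  f i + sum (removeAt f i)   ≤⟨ +-monoʳ-≤ (f i) (∑-≤1 n (f≤1 ∘ punchIn i)) ⟩
  f i + n                    ∎))
  where open ≤-Reasoning

∑-unique-≤1 : ∀ {n p} {P : Pred (Fin n) p} (P? : Decidable P) →
              (∀ {i j} → P i → P j → i ≡ j) → ∑[ i < n ] ⟦ P? i ⟧ ≤ 1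
∑-unique-≤1 {zero}  P? unique = z≤n
∑-unique-≤1 {suc n} P? unique with P? zero
... | yes p = ≤-reflexive (cong suc (∑-zero λ i →
                ⟦⟧-no (P? (suc i)) λ q → contradiction (unique p q) λ ()))
... | no  _ = ∑-unique-≤1 (P? ∘ suc) (λ p q → Fin.suc-injective (unique p q))

∑-≟ : ∀ {n} (a : Fin (suc n)) → ∑[ i < suc n ] ⟦ a ≟ i ⟧ ≡ 1
∑-≟ a = trans (sum-remove {i = a} (λ i → ⟦ a ≟ i ⟧))
  (cong₂ _+_ (⟦⟧-yes (a ≟ a) refl)
             (∑-zero λ i → ⟦⟧-no (a ≟ punchIn a i) (punchInᵢ≢i a i ∘ sym)))

∑-splitAt : ∀ m {n} (f : Fin m ⊎ Fin n → ℕ) →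
            ∑[ k < m + n ] f (splitAt m k) ≡ ∑[ i < m ] f (inj₁ i) + ∑[ j < n ] f (inj₂ j)
∑-splitAt zero    f = refl
∑-splitAt (suc m) f = trans
  (cong (f (inj₁ zero) +_) (∑-splitAt m (f ∘ Data.Sum.map suc (λ j → j))))
  (sym (+-assoc (f (inj₁ zero)) _ _))

-- By trichotomy an off-diagonal pair is increasing or the reversal of an increasing one, and
-- exchanging the summations identifies the two halves. This turns counts of edge ends at vertices
-- into counts of edges.
∑-symmetric : ∀ {n} (f : Fin n → Fin n → ℕ) → (∀ u v → f u v ≡ f v u) → (∀ u → f u u ≡ 0) →
              ∑[ u < n ] ∑[ v < n ] f u v ≡ 2 * ∑[ u < n ] ∑[ v < n ] (⟦ u <? v ⟧ * f u v)
∑-symmetric {n} f f-sym f-diag = begin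
  ∑[ u < n ] ∑[ v < n ] f u v
    ≡⟨ sum-cong-≗ (λ u → trans (sum-cong-≗ (split u)) (∑-distrib-+ (g u) (λ v → g v u))) ⟩
  ∑[ u < n ] (∑[ v < n ] g u v + ∑[ v < n ] g v u)
    ≡⟨ ∑-distrib-+ (λ u → ∑[ v < n ] g u v) (λ u → ∑[ v < n ] g v u) ⟩
  S + ∑[ u < n ] ∑[ v < n ] g v u
    ≡⟨ cong (S +_) (∑-comm (λ u v → g v u)) ⟩
  S + S
    ≡⟨ cong (S +_) (+-identityʳ S) ⟨
  2 * S ∎
  where
  open ≡-Reasoning
  g : Fin n → Fin n → ℕ
  g u v = ⟦ u <? v ⟧ * f u v
  S = ∑[ u < n ] ∑[ v < n ] g u v
  split : ∀ u v → f u v ≡ g u v + g v u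
  split u v with Fin.<-cmp u v
  ... | tri< u<v _ v≮u rewrite ⟦⟧-yes (u <? v) u<v | ⟦⟧-no (v <? u) v≮u = sym (trans (+-identityʳ _) (*-identityˡ _))
  ... | tri≈ _ refl _  rewrite f-diag u = sym (cong₂ _+_ (*-zeroʳ ⟦ u <? u ⟧) (*-zeroʳ ⟦ u <? u ⟧))
  ... | tri> u≮v _ v<u rewrite ⟦⟧-yes (v <? u) v<u | ⟦⟧-no (u <? v) u≮v = trans (f-sym u v) (sym (*-identityˡ _))

length-filter-tabulate : ∀ {n a p} {A : Set a} {P : Pred A p} (P? : Decidable P) (f : Fin n → A) →
                         length (filter P? (tabulate f)) ≡ ∑[ i < n ] ⟦ P? (f i) ⟧
length-filter-tabulate {zero}  P? f = refl
length-filter-tabulate {suc n} P? f with does (P? (f zero))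
... | true  = cong suc (length-filter-tabulate P? (f ∘ suc))
... | false = length-filter-tabulate P? (f ∘ suc)

length-filter-map : ∀ {a b p} {A : Set a} {B : Set b} {P : Pred B p} (P? : Decidable P)
                    (f : A → B) xs → length (filter P? (map f xs)) ≡ length (filter (P? ∘ f) xs)
length-filter-map P? f []       = refl
length-filter-map P? f (x ∷ xs) with does (P? (f x))
... | true  = cong suc (length-filter-map P? f xs)
... | false = length-filter-map P? f xs

length-filter-++ : ∀ {a p} {A : Set a} {P : Pred A p} (P? : Decidable P) xs ys →
                   length (filter P? (xs ++ ys)) ≡ length (filter P? xs) + length (filter P? ys)
length-filter-++ P? xs ys = trans (cong length (filter-++ P? xs ys)) (length-++ (filter P? xs))

filter-filter : ∀ {a p q} {A : Set a} {P : Pred A p} {Q : Pred A q}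
                (P? : Decidable P) (Q? : Decidable Q) xs →
                filter P? (filter Q? xs) ≡ filter (λ x → Q? x ×-dec P? x) xs
filter-filter P? Q? []       = refl
filter-filter P? Q? (x ∷ xs) with does (Q? x)
... | false = filter-filter P? Q? xs
... | true  with does (P? x)
...   | true  = cong (x ∷_) (filter-filter P? Q? xs)
...   | false = filter-filter P? Q? xs

length-filter-cartesianProduct :
  ∀ {m n a b p} {A : Set a} {B : Set b} {P : Pred (A × B) p} (P? : Decidable P)
  (f : Fin m → A) (g : Fin n → B) →
  length (filter P? (cartesianProduct (tabulate f) (tabulate g))) ≡
  ∑[ i < m ] ∑[ j < n ] ⟦ P? (f i , g j) ⟧
length-filter-cartesianProduct {zero}  P? f g = refl
length-filter-cartesianProduct {suc m} P? f g = trans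
  (length-filter-++ P? (map (f zero ,_) (tabulate g)) _)
  (cong₂ _+_ (trans (length-filter-map P? (f zero ,_) (tabulate g)) (length-filter-tabulate _ g))
             (length-filter-cartesianProduct P? (f ∘ suc) g))

-- Colour counts of a 4-total colouring

degree-∑ : ∀ {n} (G : Graph n) u → Graph.degree G u ≡ ∑[ v < n ] ⟦ Graph._~?_ G u v ⟧
degree-∑ G u = length-filter-tabulate (Graph._~?_ G u) (λ v → v)

module _ {n} {G : Graph n} (c : TotalColouring 4 G) where
  open Graph G using (_~_; _~?_; irrefl) renaming (sym to ~-sym)
  open TotalColouring c

  V : Fin 4 → ℕ
  V i = ∑[ u < n ] ⟦ vertexColour u ≟ i ⟧

  -- Adjacency is part of the condition because `edgeColour` is arbitrary at non-adjacent pairs.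
  link? : ∀ i u v → Dec (u ~ v × edgeColour u v ≡ i)
  link? i u v = (u ~? v) ×-dec (edgeColour u v ≟ i)

  link : Fin 4 → Fin n → Fin n → ℕ
  link i u v = ⟦ link? i u v ⟧

  -- The number of edges of colour `i`; the factor `⟦ u <? v ⟧` picks the same ordered pair for an
  -- edge as `edges` does.
  E : Fin 4 → ℕ
  E i = ∑[ u < n ] ∑[ v < n ] (⟦ u <? v ⟧ * link i u v)

  link-sym : ∀ i u v → link i u v ≡ link i v u
  link-sym i u v = ⟦⟧-cong (link? i u v) (link? i v u) swap swap
    where
    swap : ∀ {u v} → u ~ v × edgeColour u v ≡ i → v ~ u × edgeColour v u ≡ i
    swap (u~v , e) = ~-sym u~v , trans (sym (edge-sym u~v)) e

  link-irrefl : ∀ i u → link i u u ≡ 0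
  link-irrefl i u = ⟦⟧-no (link? i u u) (irrefl refl ∘ proj₁)

  ∑-V : ∑[ i < 4 ] V i ≡ n
  ∑-V = trans (∑-comm (λ i u → ⟦ vertexColour u ≟ i ⟧)) (∑-one n (∑-≟ ∘ vertexColour))

  ∑-link : ∀ i → ∑[ u < n ] ∑[ v < n ] link i u v ≡ 2 * E i
  ∑-link i = ∑-symmetric (link i) (link-sym i) (link-irrefl i)

  length-colourClass : ∀ i → length (colourClass i) ≡ V i + E i
  length-colourClass i = trans (length-filter-++ C? (map inj₁ (allFin n)) _) (cong₂ _+_
    (trans (length-filter-map C? inj₁ (allFin n)) (length-filter-tabulate (C? ∘ inj₁) (λ u → u)))
    (begin
      length (filter C? (map inj₂ edges))
        ≡⟨ length-filter-map C? inj₂ edges ⟩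
      length (filter (C? ∘ inj₂) edges)
        ≡⟨ cong length (filter-filter (C? ∘ inj₂) _ (cartesianProduct (allFin n) (allFin n))) ⟩
      _ ≡⟨ length-filter-cartesianProduct {n} {n} _ (λ u → u) (λ v → v) ⟩
      ∑[ u < n ] ∑[ v < n ] ⟦ ((u <? v) ×-dec (u ~? v)) ×-dec (edgeColour u v ≟ i) ⟧
        ≡⟨ sum-cong-≗ (λ u → sum-cong-≗ λ v → regroup u v) ⟩
      E i ∎))
    where
    open ≡-Reasoning
    open Graph G using (edges)
    C? = λ x → colour x ≟ i
    regroup : ∀ u v → ⟦ ((u <? v) ×-dec (u ~? v)) ×-dec (edgeColour u v ≟ i) ⟧ ≡
                      ⟦ u <? v ⟧ * link i u v
    regroup u v with does (u <? v)
    ... | true  = sym (*-identityˡ _)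
    ... | false = refl

  module _ (cubic : Cubic G) where

    -- The vertex and its three edges carry four colours in total, and no colour occurs twice among
    -- them, so the four colours are saturated.
    each-colour-once : ∀ u i → ⟦ vertexColour u ≟ i ⟧ + ∑[ v < n ] link i u v ≡ 1
    each-colour-once u = ∑-saturated 4 at-most-once (begin
      ∑[ i < 4 ] (⟦ vertexColour u ≟ i ⟧ + ∑[ v < n ] link i u v)
        ≡⟨ ∑-distrib-+ (λ i → ⟦ vertexColour u ≟ i ⟧) (λ i → ∑[ v < n ] link i u v) ⟩
      ∑[ i < 4 ] ⟦ vertexColour u ≟ i ⟧ + ∑[ i < 4 ] ∑[ v < n ] link i u v
        ≡⟨ cong₂ _+_ (∑-≟ (vertexColour u)) (∑-comm (λ i v → link i u v)) ⟩
      1 + ∑[ v < n ] ∑[ i < 4 ] link i u v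
        ≡⟨ cong suc (sum-cong-≗ λ v → edge-once v) ⟩
      1 + ∑[ v < n ] ⟦ u ~? v ⟧
        ≡⟨ cong suc (trans (sym (degree-∑ G u)) (cubic u)) ⟩
      4 ∎)
      where
      open ≡-Reasoning
      edge-once : ∀ v → ∑[ i < 4 ] link i u v ≡ ⟦ u ~? v ⟧
      edge-once v = begin
        ∑[ i < 4 ] link i u v
          ≡⟨ sum-cong-≗ (λ i → ⟦⟧-× (u ~? v) (edgeColour u v ≟ i)) ⟩
        ∑[ i < 4 ] (⟦ u ~? v ⟧ * ⟦ edgeColour u v ≟ i ⟧)
          ≡⟨ *-distribˡ-sum ⟦ u ~? v ⟧ (λ i → ⟦ edgeColour u v ≟ i ⟧) ⟨
        ⟦ u ~? v ⟧ * ∑[ i < 4 ] ⟦ edgeColour u v ≟ i ⟧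
          ≡⟨ cong (⟦ u ~? v ⟧ *_) (∑-≟ (edgeColour u v)) ⟩
        ⟦ u ~? v ⟧ * 1
          ≡⟨ *-identityʳ _ ⟩
        ⟦ u ~? v ⟧ ∎
      -- If `u` has colour `i`, no edge at `u` may have it; otherwise two edges of colour `i` at `u`
      -- must coincide.
      at-most-once : ∀ i → ⟦ vertexColour u ≟ i ⟧ + ∑[ v < n ] link i u v ≤ 1
      at-most-once i with vertexColour u ≟ i
      ... | yes c≡i = ≤-reflexive (cong suc (∑-zero λ v →
                        ⟦⟧-no (link? i u v) λ (u~v , e) → incident-ok u~v (trans c≡i (sym e))))
      ... | no  _   = ∑-unique-≤1 (link? i u) unique
        where
        unique : ∀ {v w} → u ~ v × edgeColour u v ≡ i → u ~ w × edgeColour u w ≡ i → v ≡ w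
        unique {v} {w} (u~v , e) (u~w , e′) with v ≟ w
        ... | yes v≡w = v≡w
        ... | no  v≢w = contradiction (trans e (sym e′)) (edges-ok u~v u~w v≢w)

    -- Summing `each-colour-once` over all vertices counts every edge of colour `i` at both of its
    -- ends.
    V+2E≡n : ∀ i → V i + 2 * E i ≡ n
    V+2E≡n i = begin
      V i + 2 * E i
        ≡⟨ cong (V i +_) (∑-link i) ⟨
      V i + ∑[ u < n ] ∑[ v < n ] link i u v
        ≡⟨ ∑-distrib-+ (λ u → ⟦ vertexColour u ≟ i ⟧) (λ u → ∑[ v < n ] link i u v) ⟨
      ∑[ u < n ] (⟦ vertexColour u ≟ i ⟧ + ∑[ v < n ] link i u v)
        ≡⟨ ∑-one n (λ u → each-colour-once u i) ⟩
      n ∎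
      where open ≡-Reasoning

    2*length-colourClass : ∀ i → 2 * length (colourClass i) ≡ n + V i
    2*length-colourClass i = begin
      2 * length (colourClass i)   ≡⟨ cong (2 *_) (length-colourClass i) ⟩
      2 * (V i + E i)              ≡⟨ rearrange (V i) (E i) ⟩
      V i + 2 * E i + V i          ≡⟨ cong (_+ V i) (V+2E≡n i) ⟩
      n + V i                      ∎
      where
      open ≡-Reasoning
      rearrange : ∀ v e → 2 * (v + e) ≡ v + 2 * e + v
      rearrange = solve-∀

    -- Each vertex of colour `i` is charged to its edge of colour `j` twice, once as first and once
    -- as second endpoint of an oriented edge. These charges fit into the `2 * E j` oriented edges
    -- of colour `j`.
    2V+V≤n : ∀ {i j} → i ≢ j → 2 * V i + V j ≤ n
    2V+V≤n {i} {j} i≢j = begin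
      2 * V i + V j
        ≡⟨ cong (_+ V j) (cong (V i +_) (+-identityʳ (V i))) ⟩
      V i + V i + V j
        ≡⟨ cong (_+ V j) (cong₂ _+_ (sum-cong-≗ spread) (trans (sum-cong-≗ spread) transposed)) ⟩
      ∑[ u < n ] ∑[ v < n ] (I u * link j u v) + ∑[ u < n ] ∑[ v < n ] (I v * link j u v) + V j
        ≡⟨ cong (_+ V j) (trans (sum-cong-≗ (λ u → ∑-distrib-+ (λ v → I u * link j u v) (λ v → I v * link j u v)))
            (∑-distrib-+ (λ u → ∑[ v < n ] (I u * link j u v)) (λ u → ∑[ v < n ] (I v * link j u v)))) ⟨
      ∑[ u < n ] ∑[ v < n ] (I u * link j u v + I v * link j u v) + V j
        ≤⟨ +-monoˡ-≤ (V j) (∑-mono-≤ λ u → ∑-mono-≤ λ v → independent u v) ⟩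
      ∑[ u < n ] ∑[ v < n ] link j u v + V j
        ≡⟨ cong (_+ V j) (∑-link j) ⟩
      2 * E j + V j
        ≡⟨ trans (+-comm (2 * E j) (V j)) (V+2E≡n j) ⟩
      n ∎
      where
      open ≤-Reasoning
      I : Fin n → ℕ
      I u = ⟦ vertexColour u ≟ i ⟧
      -- A vertex of colour `i ≢ j` meets colour `j` on exactly one edge.
      spread : ∀ u → I u ≡ ∑[ v < n ] (I u * link j u v)
      spread u with vertexColour u ≟ i
      ... | no  _   = sym (∑-zero {n} λ _ → refl)
      ... | yes c≡i = trans
        (sym (trans (cong (_+ ∑[ v < n ] link j u v) (sym (⟦⟧-no (vertexColour u ≟ j) λ c≡j → i≢j (trans (sym c≡i) c≡j))))
                    (each-colour-once u j)))
        (sum-cong-≗ λ v → sym (*-identityˡ (link j u v)))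
      transposed : ∑[ u < n ] ∑[ v < n ] (I u * link j u v) ≡ ∑[ u < n ] ∑[ v < n ] (I v * link j u v)
      transposed = trans (∑-comm (λ u v → I u * link j u v))
        (sum-cong-≗ λ u → sum-cong-≗ λ v → cong (I v *_) (link-sym j v u))
      -- No edge has both ends of colour `i`, so an oriented edge receives at most one of the two
      -- charges.
      independent : ∀ u v → I u * link j u v + I v * link j u v ≤ link j u v
      independent u v with vertexColour u ≟ i | vertexColour v ≟ i
      ... | no _    | no _    = z≤n
      ... | yes _   | no _    = ≤-reflexive (trans (+-identityʳ _) (*-identityˡ _))
      ... | no _    | yes _   = ≤-reflexive (*-identityˡ _)
      ... | yes c≡i | yes d≡i
        rewrite ⟦⟧-no (link? j u v) (λ (u~v , _) → vertices-ok u~v (trans c≡i (sym d≡i))) = z≤n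

-- Equitability at small orders

-- `τ` enumerates the indices other than `i` and `j`; with `m = 2` it names the two remaining
-- colours.
∑-remove₂ : ∀ {m} {i j : Fin (2 + m)} → i ≢ j → ∃ λ (τ : Fin m → Fin (2 + m)) →
            (∀ {k l} → k ≢ l → τ k ≢ τ l) × (∀ k → i ≢ τ k) ×
            (∀ f → sum f ≡ f i + (f j + ∑[ k < m ] f (τ k)))
∑-remove₂ {m} {i} {j} i≢j = punchIn i ∘ punchIn j′ , injective , (λ k → punchInᵢ≢i i _ ∘ sym) , split
  where
  j′ = punchOut i≢j
  injective : ∀ {k l} → k ≢ l → punchIn i (punchIn j′ k) ≢ punchIn i (punchIn j′ l)
  injective k≢l = k≢l ∘ punchIn-injective j′ _ _ ∘ punchIn-injective i _ _
  split : ∀ f → sum f ≡ f i + (f j + ∑[ k < m ] f (punchIn i (punchIn j′ k)))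
  split f = trans (sum-remove {i = i} f) (cong (f i +_)
    (trans (sum-remove {i = j′} (f ∘ punchIn i))
           (cong (λ z → f z + ∑[ k < m ] f (punchIn i (punchIn j′ k))) (punchIn-punchOut i≢j))))

-- The arithmetic core: the letters stand for the half counts of the four colours, two of which
-- differ by at least 2. A total of 6 arises only from `2 , 0 , 2 , 2`.
gap⇒6∨≥8 : ∀ {a b c d} → 2 + b ≤ a → a ≤ b + c → a ≤ b + d → c ≤ a + b → d ≤ a + b →
           a + (b + (c + d)) ≡ 6 ⊎ 8 ≤ a + (b + (c + d))
gap⇒6∨≥8 {a} {suc b} {c} {d} gap a≤b+c a≤b+d _ _ = inj₂
  -- With a positive second entry the gap gives `a ≥ 3` and forces `c` and `d` to be at least 2, so
  -- the total is at least 3 + 1 + 2 + 2.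
  (+-mono-≤ {3} {a} (≤-trans (s≤s (s≤s (s≤s z≤n))) gap)
    (+-mono-≤ {1} {suc b} (s≤s z≤n) (+-mono-≤ {2} {c} {2} {d} (2≤ a≤b+c) (2≤ a≤b+d))))
  where
  2≤ : ∀ {x} → a ≤ suc b + x → 2 ≤ x
  2≤ {x} a≤b+x = +-cancelˡ-≤ (suc b) 2 x (≤-trans (≤-reflexive (+-comm (suc b) 2)) (≤-trans gap a≤b+x))
gap⇒6∨≥8 {1}                 {zero} (s≤s ())
gap⇒6∨≥8 {2}                 {zero} gap a≤c a≤d c≤a d≤a =
  inj₁ (cong (2 +_) (cong₂ _+_ (≤-antisym c≤a a≤c) (≤-antisym d≤a a≤d)))
gap⇒6∨≥8 {suc (suc (suc a))} {zero} {c} {d} gap a≤c a≤d _ _ = inj₂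
  -- With a zero second entry `c` and `d` are at least the first entry, which is at least 3 here, so
  -- the total is at least 9.
  (≤-trans (n≤1+n 8) (+-mono-≤ {3} {3 + a} 3≤ (+-mono-≤ {3} {c} {3} {d} (≤-trans 3≤ a≤c) (≤-trans 3≤ a≤d))))
  where
  3≤ : 3 ≤ 3 + a
  3≤ = m≤m+n 3 a

private
  -- Each regrouping puts the pair of colours compared by `x-triangle` in front.
  ad|bc : ∀ a b c d → a + (b + (c + d)) ≡ (a + d) + (b + c)
  ad|bc = solve-∀
  ac|bd : ∀ a b c d → a + (b + (c + d)) ≡ (a + c) + (b + d)
  ac|bd = solve-∀
  cd|ab : ∀ a b c d → a + (b + (c + d)) ≡ (c + d) + (a + b)
  cd|ab = solve-∀
  dc|ab : ∀ a b c d → a + (b + (c + d)) ≡ (d + c) + (a + b)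
  dc|ab = solve-∀

-- In terms of a colouring, N = n / 2 and x i = v_i / 2.
module _ {N} (x : Fin 4 → ℕ) (∑x≡N : sum x ≡ N) (2x+x≤N : ∀ {i j} → i ≢ j → 2 * x i + x j ≤ N) where

  -- Cancelling `x i + x j` in `2 * x i + x j ≤ N` bounds one colour by the total `r` of the two
  -- colours outside the pair.
  x-triangle : ∀ {i j r} → i ≢ j → N ≡ (x i + x j) + r → x i ≤ r
  x-triangle {i} {j} {r} i≢j N≡ = +-cancelˡ-≤ (x i + x j) (x i) r
    (subst (_ ≤_) N≡ (≤-trans (≤-reflexive (rearrange (x i) (x j))) (2x+x≤N i≢j)))
    where
    rearrange : ∀ p q → p + q + p ≡ 2 * p + q
    rearrange = solve-∀

  -- The inequalities passed on come from pairing `i` with each of the two remaining colours, and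
  -- those two with each other in both orders.
  x-gap : ∀ {i j} → 2 + x j ≤ x i → N ≡ 6 ⊎ 8 ≤ N
  x-gap {i} {j} gap with i ≟ j
  ... | yes refl = contradiction gap (<⇒≱ (n≤1+n _))
  ... | no i≢j with τ , τ-injective , i≢τ , split ← ∑-remove₂ i≢j =
    subst (λ z → z ≡ 6 ⊎ 8 ≤ z) (sym N≡)
      (gap⇒6∨≥8 gap
        (x-triangle (i≢τ (suc zero)) (trans N≡ (ad|bc a b k l)))
        (x-triangle (i≢τ zero) (trans N≡ (ac|bd a b k l)))
        (x-triangle k≢l (trans N≡ (cd|ab a b k l)))
        (x-triangle (k≢l ∘ sym) (trans N≡ (dc|ab a b k l))))
    where
    a = x i
    b = x j
    k = x (τ zero)
    l = x (τ (suc zero))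
    k≢l : τ zero ≢ τ (suc zero)
    k≢l = τ-injective λ ()
    N≡ : N ≡ a + (b + (k + l))
    N≡ = trans (sym ∑x≡N) (trans (split x) (cong (λ z → a + (b + (k + z))) (+-identityʳ l)))

  x-≤1+ : N ≢ 6 → N < 8 → ∀ i j → x i ≤ x j + 1
  x-≤1+ N≢6 N<8 i j = ≤-trans (≮⇒≥ λ gap → [ N≢6 , <⇒≱ N<8 ]′ (x-gap {i} {j} gap))
                              (≤-reflexive (+-comm 1 (x j)))

  x-balanced : N ≢ 6 → N < 8 → ∀ i j → ∣ x i - x j ∣ ≤ 1
  x-balanced N≢6 N<8 i j with ≤-total (x i) (x j)
  ... | inj₁ i≤j = subst (_≤ 1) (sym (m≤n⇒∣m-n∣≡n∸m i≤j)) (m≤n+o⇒m∸n≤o (x j) (x i) (x-≤1+ N≢6 N<8 j i))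
  ... | inj₂ j≤i = subst (_≤ 1) (sym (m≤n⇒∣n-m∣≡n∸m j≤i)) (m≤n+o⇒m∸n≤o (x i) (x j) (x-≤1+ N≢6 N<8 i j))

-- A positive entry must equal 1 and forces all other entries to vanish, so the sum would be 0 or 1.
sum≡2⇒unbounded : ∀ (x : Fin 4 → ℕ) → sum x ≡ 2 → ¬ (∀ {i j} → i ≢ j → 2 * x i + x j ≤ 2)
sum≡2⇒unbounded x ∑x≡2 bound = contradiction (trans (sym ∑x≡2) (∑-zero x≡0)) λ ()
  where
  vanish : ∀ a b → 2 * suc a + b ≤ 2 → a ≡ 0 × b ≡ 0
  vanish a b p with n≤0⇒n≡0 (≤-pred (*-cancelˡ-≤ 2 (m+n≤o⇒m≤o (2 * suc a) p)))
  ... | refl = refl , n≤0⇒n≡0 (+-cancelˡ-≤ 2 b 0 p)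
  x≡0 : ∀ i → x i ≡ 0
  x≡0 i with x i in eq
  ... | zero  = refl
  ... | suc a = contradiction
    (begin
      2                                      ≡⟨ ∑x≡2 ⟨
      sum x                                  ≡⟨ sum-remove {i = i} x ⟩
      x i + sum (x ∘ punchIn i)              ≡⟨ cong₂ _+_ (trans eq (cong suc (proj₁ (v zero)))) (∑-zero (proj₂ ∘ v)) ⟩
      1                                      ∎)
    λ ()
    where
    open ≡-Reasoning
    v : ∀ k → a ≡ 0 × x (punchIn i k) ≡ 0
    v k = vanish a _ (subst (λ z → 2 * z + x (punchIn i k) ≤ 2) eq (bound (punchInᵢ≢i i k ∘ sym)))

module _ {N} {G : Graph (N * 2)} (cubic : Cubic G) (c : TotalColouring 4 G) where
  open TotalColouring c using (colourClass; Equitable)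

  2∣V : ∀ i → 2 ∣ V c i
  2∣V i = ∣m+n∣m⇒∣n
    (subst (2 ∣_) (trans (sym (V+2E≡n c cubic i)) (+-comm (V c i) _)) (n∣m*n N))
    (subst (2 ∣_) (*-comm (E c i) 2) (n∣m*n (E c i)))

  x : Fin 4 → ℕ
  x i = _∣_.quotient (2∣V i)

  V≡x*2 : ∀ i → V c i ≡ x i * 2
  V≡x*2 i = _∣_.equality (2∣V i)

  ∑x≡N : sum x ≡ N
  ∑x≡N = *-cancelʳ-≡ (sum x) N 2
    (trans (*-distribʳ-sum 2 x) (trans (sym (sum-cong-≗ V≡x*2)) (∑-V c)))

  length-colourClass′ : ∀ i → length (colourClass i) ≡ N + x i
  length-colourClass′ i = *-cancelˡ-≡ _ _ 2 (begin
    2 * length (colourClass i)   ≡⟨ 2*length-colourClass c cubic i ⟩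
    N * 2 + V c i                ≡⟨ cong (N * 2 +_) (V≡x*2 i) ⟩
    N * 2 + x i * 2              ≡⟨ rearrange N (x i) ⟩
    2 * (N + x i)                ∎)
    where
    open ≡-Reasoning
    rearrange : ∀ p q → p * 2 + q * 2 ≡ 2 * (p + q)
    rearrange = solve-∀

  2x+x≤N : ∀ {i j} → i ≢ j → 2 * x i + x j ≤ N
  2x+x≤N {i} {j} i≢j = *-cancelʳ-≤ _ _ 2 (begin
    (2 * x i + x j) * 2       ≡⟨ rearrange (x i) (x j) ⟩
    2 * (x i * 2) + x j * 2   ≡⟨ cong₂ (λ p q → 2 * p + q) (V≡x*2 i) (V≡x*2 j) ⟨
    2 * V c i + V c j         ≤⟨ 2V+V≤n c cubic i≢j ⟩
    N * 2                     ∎)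
    where
    open ≤-Reasoning
    rearrange : ∀ p q → (2 * p + q) * 2 ≡ 2 * (p * 2) + q * 2
    rearrange = solve-∀

  small⇒equitable : N ≢ 6 → N < 8 → Equitable
  small⇒equitable N≢6 N<8 i j = subst (_≤ 1) (begin
    ∣ x i - x j ∣                      ≡⟨ ∣m+n-m+o∣≡∣n-o∣ N (x i) (x j) ⟨
    ∣ N + x i - N + x j ∣              ≡⟨ cong₂ ∣_-_∣ (length-colourClass′ i) (length-colourClass′ j) ⟨
    ∣ length (colourClass i) - length (colourClass j) ∣ ∎)
    (x-balanced x ∑x≡N 2x+x≤N N≢6 N<8 i j)
    where open ≡-Reasoning

-- Here `N = 2`, and the half counts of a colouring would contradict `sum≡2⇒unbounded`.
four-uncolourable : (G : Graph 4) → Cubic G → ¬ TotalColouring 4 G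
four-uncolourable G cubic c = sum≡2⇒unbounded (x {2} cubic c) (∑x≡N {2} cubic c) (2x+x≤N {2} cubic c)

AllEquitable-small : ∀ {N} → N ≢ 6 → N < 8 → AllEquitable (N * 2)
AllEquitable-small N≢6 N<8 G cubic c = small⇒equitable cubic c N≢6 N<8

-- Inequitable colourings

-- `d` bounds from below how many more vertices have colour 0 than colour 3. Comparing two fixed
-- colours makes these bounds additive under disjoint union.
record Block (d n : ℕ) : Set₁ where
  field
    graph     : Graph n
    cubic     : Cubic graph
    colouring : TotalColouring 4 graph
    surplus   : V colouring (suc (suc (suc zero))) + d ≤ V colouring zero

-- A surplus of 4 vertices makes the doubled class sizes differ by at least 4, while equitability
-- allows only 2.
inequitable : ∀ {n} → Block 4 n → ¬ AllEquitable n
inequitable {n} B equitable = <⇒≱ (m≤m+n 3 1) (+-cancelˡ-≤ (n + v₃) 4 2 (begin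
  n + v₃ + 4           ≡⟨ +-assoc n v₃ 4 ⟩
  n + (v₃ + 4)         ≤⟨ +-monoʳ-≤ n surplus ⟩
  n + V colouring zero ≡⟨ 2*length-colourClass colouring cubic zero ⟨
  2 * c₀               ≤⟨ *-monoʳ-≤ 2 (m≤n+∣m-n∣ c₀ c₃) ⟩
  2 * (c₃ + ∣ c₀ - c₃ ∣) ≤⟨ *-monoʳ-≤ 2 (+-monoʳ-≤ c₃ (equitable graph cubic colouring _ _)) ⟩
  2 * (c₃ + 1)         ≡⟨ *-distribˡ-+ 2 c₃ 1 ⟩
  2 * c₃ + 2           ≡⟨ cong (_+ 2) (2*length-colourClass colouring cubic (suc (suc (suc zero)))) ⟩
  n + v₃ + 2           ∎))
  where
  open Block B
  open ≤-Reasoning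
  v₃ = V colouring (suc (suc (suc zero)))
  c₀ = length (TotalColouring.colourClass colouring zero)
  c₃ = length (TotalColouring.colourClass colouring (suc (suc (suc zero))))

-- Disjoint unions of blocks

module _ {d e m n} (A : Block d m) (B : Block e n) where
  private
    module A = Block A
    module B = Block B
    module GA = Graph A.graph
    module GB = Graph B.graph
    module CA = TotalColouring A.colouring
    module CB = TotalColouring B.colouring

    _~⊎_ : Fin m ⊎ Fin n → Fin m ⊎ Fin n → Set
    _~⊎_ = Pointwise GA._~_ GB._~_

    _~⊎?_ : ∀ u v → Dec (u ~⊎ v)
    _~⊎?_ = ⊎.⊎-decidable GA._~?_ GB._~?_

    vertexColour⊎ : Fin m ⊎ Fin n → Fin 4
    vertexColour⊎ = [ CA.vertexColour , CB.vertexColour ]′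

    edgeColour⊎ : Fin m ⊎ Fin n → Fin m ⊎ Fin n → Fin 4
    edgeColour⊎ (inj₁ u) (inj₁ v) = CA.edgeColour u v
    edgeColour⊎ (inj₂ u) (inj₂ v) = CB.edgeColour u v
    -- Vertices of different summands are never adjacent, so this value is a placeholder.
    edgeColour⊎ _        _        = zero

    edge-sym⊎ : ∀ {u v} → u ~⊎ v → edgeColour⊎ u v ≡ edgeColour⊎ v u
    edge-sym⊎ (inj₁ u~v) = CA.edge-sym u~v
    edge-sym⊎ (inj₂ u~v) = CB.edge-sym u~v

    vertices-ok⊎ : ∀ {u v} → u ~⊎ v → vertexColour⊎ u ≢ vertexColour⊎ v
    vertices-ok⊎ (inj₁ u~v) = CA.vertices-ok u~v
    vertices-ok⊎ (inj₂ u~v) = CB.vertices-ok u~v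

    edges-ok⊎ : ∀ {u v w} → u ~⊎ v → u ~⊎ w → v ≢ w → edgeColour⊎ u v ≢ edgeColour⊎ u w
    edges-ok⊎ (inj₁ u~v) (inj₁ u~w) v≢w = CA.edges-ok u~v u~w (v≢w ∘ cong inj₁)
    edges-ok⊎ (inj₂ u~v) (inj₂ u~w) v≢w = CB.edges-ok u~v u~w (v≢w ∘ cong inj₂)

    incident-ok⊎ : ∀ {u v} → u ~⊎ v → vertexColour⊎ u ≢ edgeColour⊎ u v
    incident-ok⊎ (inj₁ u~v) = CA.incident-ok u~v
    incident-ok⊎ (inj₂ u~v) = CB.incident-ok u~v

    degree⊎ : ∀ u → ∑[ i < m ] ⟦ u ~⊎? inj₁ i ⟧ + ∑[ j < n ] ⟦ u ~⊎? inj₂ j ⟧ ≡ 3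
    degree⊎ (inj₁ u) = cong₂ _+_ (trans (sym (degree-∑ A.graph u)) (A.cubic u)) (∑-zero {n} λ _ → refl)
    degree⊎ (inj₂ u) = cong₂ _+_ (∑-zero {m} λ _ → refl) (trans (sym (degree-∑ B.graph u)) (B.cubic u))

    splitAt-injective : ∀ {u v : Fin (m + n)} → splitAt m u ≡ splitAt m v → u ≡ v
    splitAt-injective {u} {v} eq =
      trans (sym (join-splitAt m n u)) (trans (cong (join m n) eq) (join-splitAt m n v))

    G : Graph (m + n)
    G = record
      { _~_    = _~⊎_ on splitAt m
      ; _~?_   = λ u v → splitAt m u ~⊎? splitAt m v
      ; sym    = ⊎.⊎-symmetric GA.sym GB.sym
      ; irrefl = λ { {u} refl → ⊎.⊎-irreflexive GA.irrefl GB.irrefl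
                                  (⊎.⊎-refl refl refl {splitAt m u}) }
      }

    colouring : TotalColouring 4 G
    colouring = record
      { vertexColour = vertexColour⊎ ∘ splitAt m
      ; edgeColour   = edgeColour⊎ on splitAt m
      ; edge-sym     = edge-sym⊎
      ; vertices-ok  = vertices-ok⊎
      ; edges-ok     = λ u~v u~w v≢w → edges-ok⊎ u~v u~w (v≢w ∘ splitAt-injective)
      ; incident-ok  = incident-ok⊎
      }

    V-⊎ : ∀ i → V colouring i ≡ V A.colouring i + V B.colouring i
    V-⊎ i = ∑-splitAt m (λ u → ⟦ vertexColour⊎ u ≟ i ⟧)

  -- Both summands keep their colours, so vertex counts add colour by colour and the surpluses add
  -- with them.
  _⊎ᴮ_ : Block (d + e) (m + n)
  _⊎ᴮ_ = record
    { graph     = G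
    ; cubic     = λ u → trans (degree-∑ G u)
                    (trans (∑-splitAt m (λ v → ⟦ splitAt m u ~⊎? v ⟧)) (degree⊎ (splitAt m u)))
    ; colouring = colouring
    ; surplus   = begin
        V colouring three + (d + e)
          ≡⟨ cong (_+ (d + e)) (V-⊎ three) ⟩
        V A.colouring three + V B.colouring three + (d + e)
          ≡⟨ interchange (V A.colouring three) (V B.colouring three) d e ⟩
        (V A.colouring three + d) + (V B.colouring three + e)
          ≤⟨ +-mono-≤ A.surplus B.surplus ⟩
        V A.colouring zero + V B.colouring zero
          ≡⟨ V-⊎ zero ⟨
        V colouring zero ∎
    }
    where
    open ≤-Reasoning
    three : Fin 4
    three = suc (suc (suc zero))
    interchange : ∀ p q r s → p + q + (r + s) ≡ (p + r) + (q + s)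
    interchange = solve-∀

-- Coloured graphs from tables

-- Row i of σ sends each vertex to its neighbour along the edge of colour i, and fixes
-- the vertices of colour i.
module Table {n} (σ : Vec (Vec ℕ n) 4) where

  joined? : (u v : Fin n) → Dec (∃ λ i → lookup (lookup σ i) u ≡ toℕ v)
  joined? u v = any? λ i → lookup (lookup σ i) u ℕ.≟ toℕ v

  -- A fixed point of a row records a vertex colour, not a loop, hence the condition `u ≢ v`.
  _~_ : Fin n → Fin n → Set
  u ~ v = u ≢ v × ∃ λ i → lookup (lookup σ i) u ≡ toℕ v

  _~?_ : ∀ u v → Dec (u ~ v)
  u ~? v = ¬? (u ≟ v) ×-dec joined? u v

  -- The default zero is reached only at non-adjacent pairs u ≢ v of a valid table.
  colourOf : Fin n → Fin n → Fin 4
  colourOf u v with joined? u v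
  ... | yes (i , _) = i
  ... | no _        = zero

  -- `colourOf u u` is the row fixing `u`, that is, the colour of the vertex, so this is `V` of the
  -- resulting colouring.
  count : Fin 4 → ℕ
  count i = ∑[ u < n ] ⟦ colourOf u u ≟ i ⟧

  -- The requirements of `Block d n` over finite quantifiers, so that `valid?` settles them by
  -- evaluation; irreflexivity is built into `_~_`.
  Valid : ℕ → Set
  Valid d =
    (∀ u v → u ~ v → v ~ u × colourOf u v ≡ colourOf v u × colourOf u u ≢ colourOf v v ×
                     colourOf u u ≢ colourOf u v ×
                     (∀ w → u ~ w → v ≢ w → colourOf u v ≢ colourOf u w)) ×
    (∀ u → length (filter (u ~?_) (allFin n)) ≡ 3) ×
    count (suc (suc (suc zero))) + d ≤ count zero

  valid? : ∀ d → Dec (Valid d)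
  valid? d =
    (all? λ u → all? λ v → (u ~? v) →-dec
      ((v ~? u) ×-dec (colourOf u v ≟ colourOf v u) ×-dec ¬? (colourOf u u ≟ colourOf v v) ×-dec
       ¬? (colourOf u u ≟ colourOf u v) ×-dec
       (all? λ w → (u ~? w) →-dec (¬? (v ≟ w) →-dec ¬? (colourOf u v ≟ colourOf u w))))) ×-dec
    (all? λ u → length (filter (u ~?_) (allFin n)) ℕ.≟ 3) ×-dec
    (count (suc (suc (suc zero))) + d ℕ.≤? count zero)

  block : ∀ d → {True (valid? d)} → Block d n
  block d {valid} with local , cubic , surplus ← toWitness valid = record
    { graph     = record
      { _~_    = _~_
      ; _~?_   = _~?_
      ; sym    = λ {u} {v} u~v → proj₁ (local u v u~v)
      ; irrefl = λ u≡v (u≢v , _) → u≢v u≡v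
      }
    ; cubic     = cubic
    ; colouring = record
      { vertexColour = λ u → colourOf u u
      ; edgeColour   = colourOf
      ; edge-sym     = λ {u} {v} u~v → proj₁ (proj₂ (local u v u~v))
      ; vertices-ok  = λ {u} {v} u~v → proj₁ (proj₂ (proj₂ (local u v u~v)))
      ; edges-ok     = λ {u} {v} {w} u~v → proj₂ (proj₂ (proj₂ (proj₂ (local u v u~v)))) w
      ; incident-ok  = λ {u} {v} u~v → proj₁ (proj₂ (proj₂ (proj₂ (local u v u~v))))
      }
    ; surplus   = surplus
    }

-- Colour 3 is the matching between the triangles `0 1 2` and `3 4 5`; every other colour fixes one
-- vertex in each triangle.
prism₆ : Block 2 6
prism₆ = Table.block
  ( (0 ∷ 2 ∷ 1 ∷ 5 ∷ 4 ∷ 3 ∷ [])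
  ∷ (1 ∷ 0 ∷ 2 ∷ 3 ∷ 5 ∷ 4 ∷ [])
  ∷ (2 ∷ 1 ∷ 0 ∷ 4 ∷ 3 ∷ 5 ∷ [])
  ∷ (3 ∷ 4 ∷ 5 ∷ 0 ∷ 1 ∷ 2 ∷ [])
  ∷ []) 2

-- Each colour is given to a pair of antipodal vertices of the cube, so this block changes the order
-- but not the surplus.
cube₈ : Block 0 8
cube₈ = Table.block
  ( (0 ∷ 5 ∷ 3 ∷ 2 ∷ 7 ∷ 1 ∷ 6 ∷ 4 ∷ [])
  ∷ (1 ∷ 0 ∷ 2 ∷ 7 ∷ 4 ∷ 6 ∷ 5 ∷ 3 ∷ [])
  ∷ (3 ∷ 1 ∷ 6 ∷ 0 ∷ 5 ∷ 4 ∷ 2 ∷ 7 ∷ [])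
  ∷ (4 ∷ 2 ∷ 1 ∷ 3 ∷ 0 ∷ 5 ∷ 7 ∷ 6 ∷ [])
  ∷ []) 0

block₁₀ : Block 2 10
block₁₀ = Table.block
  ( (0 ∷ 1 ∷ 2 ∷ 3 ∷ 5 ∷ 4 ∷ 7 ∷ 6 ∷ 9 ∷ 8 ∷ [])
  ∷ (4 ∷ 6 ∷ 5 ∷ 8 ∷ 0 ∷ 2 ∷ 1 ∷ 7 ∷ 3 ∷ 9 ∷ [])
  ∷ (7 ∷ 8 ∷ 9 ∷ 4 ∷ 3 ∷ 5 ∷ 6 ∷ 0 ∷ 1 ∷ 2 ∷ [])
  ∷ (9 ∷ 7 ∷ 6 ∷ 5 ∷ 4 ∷ 3 ∷ 2 ∷ 1 ∷ 8 ∷ 0 ∷ [])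
  ∷ []) 2

-- Assembling the orders

weaken : ∀ {d e n} → d ≤ e → Block e n → Block d n
weaken d≤e B = record
  { graph     = graph
  ; cubic     = cubic
  ; colouring = colouring
  ; surplus   = ≤-trans (+-monoʳ-≤ _ d≤e) surplus
  }
  where open Block B

-- One more prism adds 3 to half the order, so the recursion steps by 3 from the orders 16, 18 and
-- 20. Surpluses of 6 are lowered to 4 to keep one type.
large-block : ∀ k → Block 4 ((8 + k) * 2)
large-block 0 = prism₆ ⊎ᴮ block₁₀
large-block 1 = weaken (m≤m+n 4 2) (prism₆ ⊎ᴮ (prism₆ ⊎ᴮ prism₆))
large-block 2 = prism₆ ⊎ᴮ (prism₆ ⊎ᴮ cube₈)
large-block (suc (suc (suc k))) = weaken (m≤n+m 4 2) (prism₆ ⊎ᴮ large-block k)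

orders : List ℕ
orders = 4 ∷ 6 ∷ 8 ∷ 10 ∷ 14 ∷ []

-- Under `n = N * 2` these are the conditions `N ≢ 6` and `N < 8` of `AllEquitable-small`.
orders-bound : All (λ n → n ≢ 12 × n ≤ 14) orders
orders-bound = from-yes (All.all? (λ n → ¬? (n ℕ.≟ 12) ×-dec (n ℕ.≤? 14)) orders)

∈orders⇒AllEquitable : ∀ {n} → 2 ∣ n → n ∈ orders → AllEquitable n
∈orders⇒AllEquitable (divides N refl) n∈ with n≢12 , n≤14 ← All.lookup orders-bound n∈ =
  -- The bound 14 is relaxed to `N * 2 < 8 * 2` so that the factor 2 cancels.
  AllEquitable-small (n≢12 ∘ cong (_* 2)) (*-cancelʳ-< 2 N 8 (s≤s (≤-trans n≤14 (n≤1+n 14))))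

AllEquitable⇒∈orders : ∀ {n} → 4 ≤ n → 2 ∣ n → AllEquitable n → n ∈ orders
AllEquitable⇒∈orders 4≤n (divides 0 refl) _ = contradiction 4≤n λ ()
AllEquitable⇒∈orders 4≤n (divides 1 refl) _ = contradiction 4≤n λ { (s≤s (s≤s ())) }
AllEquitable⇒∈orders _ (divides 2 refl) _ = here refl
AllEquitable⇒∈orders _ (divides 3 refl) _ = there (here refl)
AllEquitable⇒∈orders _ (divides 4 refl) _ = there (there (here refl))
AllEquitable⇒∈orders _ (divides 5 refl) _ = there (there (there (here refl)))
AllEquitable⇒∈orders _ (divides 6 refl) equitable =
  -- Two prisms, each of surplus 2, reach the required 4 at order 12.
  contradiction equitable (inequitable (prism₆ ⊎ᴮ prism₆))
AllEquitable⇒∈orders _ (divides 7 refl) _ = there (there (there (there (here refl))))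
AllEquitable⇒∈orders _ (divides (suc (suc (suc (suc (suc (suc (suc (suc k)))))))) refl) equitable =
  contradiction equitable (inequitable (large-block k))

K₄-cubic : Cubic (Complete 4)
K₄-cubic = from-yes (all? λ u → Graph.degree (Complete 4) u ℕ.≟ 3)

corollary6p3 : ((n : ℕ) → 4 ≤ n → 2 ∣ n →
    (AllEquitable n ⇔ n ∈ (4 ∷ 6 ∷ 8 ∷ 10 ∷ 14 ∷ [])))
    × (¬ TotalColouring 4 (Complete 4)
    × ((G : Graph 4) → Cubic G → ¬ TotalColouring 4 G))
    × (AllEquitable 14
    × ((n : ℕ) → 4 ≤ n → 2 ∣ n → AllEquitable n → n ≤ 14))
corollary6p3 =
    (λ n 4≤n 2∣n → mk⇔ (AllEquitable⇒∈orders 4≤n 2∣n) (∈orders⇒AllEquitable 2∣n))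
  , (four-uncolourable (Complete 4) K₄-cubic , four-uncolourable)
  , ( AllEquitable-small {7} (λ ()) ≤-refl
    , λ n 4≤n 2∣n equitable →
        proj₂ (All.lookup orders-bound (AllEquitable⇒∈orders 4≤n 2∣n equitable)))
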